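{- Let $\sigma$ be a finite relational signature, let $\varphi\in\mathsf{FL}[0](\sigma)$ be a fluted sentence, and put $n:=\operatorname{qr}(\varphi)$. The following are equivalent, with preservation and equivalence taken over all (finite or infinite) $\sigma$-structures: (i) $\varphi$ is preserved under homomorphisms, i.e. for all $\sigma$-structures $\mathfrak A,\mathfrak B$ and every homomorphism $h:\mathfrak A\to\mathfrak B$, if $\mathfrak A\models\varphi$ then $\mathfrak B\models\varphi$; (ii) $\varphi$ is equivalent to some existential-positive fluted sentence $\psi\in\exists^{+}\mathsf{FL}[0](\sigma)$ with $\operatorname{qr}(\psi)\le n$.
   Context: Signatures $\sigma$ are finite sets of relation symbols of positive arity (no equality, constants or function symbols). All structures have non-empty domains; the domain of $\mathfrak A$ is denoted $A$. Fluted fragment. Fix variables $x_1,x_2,\ldots$. The levels $\mathsf{FL}[m](\sigma)$, $m\ge 0$, are defined by simultaneous induction: $\top,\bot\in\mathsf{FL}[m](\sigma)$; if $R\in\sigma$ has arity $r\le m$, then the suffix atom $R(x_{m-r+1},\ldots,x_m)$ is in $\mathsf{FL}[m](\sigma)$; $\mathsf{FL}[m](\sigma)$ is closed under $\neg,\wedge,\vee$; if $\varphi\in\mathsf{FL}[m+1](\sigma)$, then $\exists x_{m+1}\varphi$ and $\forall x_{m+1}\varphi$ are in $\mathsf{FL}[m](\sigma)$. $\mathsf{FL}[0](\sigma)$ is the set of fluted sentences. Semantics is the usual first-order one. The quantifier rank $\operatorname{qr}$ is the usual one (0 on atoms and truth constants, unchanged by negation, max over $\wedge,\vee$, plus one for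 each quantifier). The existential-positive levels $\exists^{+}\mathsf{FL}[m](\sigma)$ are generated in the same way from the permitted suffix atoms and truth constants using only $\wedge$, $\vee$ and existential quantification (if $\varphi\in\exists^{+}\mathsf{FL}[m+1](\sigma)$ then $\exists x_{m+1}\varphi\in\exists^{+}\mathsf{FL}[m](\sigma)$). A homomorphism $h:\mathfrak A\to\mathfrak B$ is a map $A\to B$ such that $R^{\mathfrak A}(a_1,\ldots,a_r)$ implies $R^{\mathfrak B}(h(a_1),\ldots,h(a_r))$ for all $r$-ary $R\in\sigma$ and $a_1,\dots,a_r\in A$. -}

module Defs where

open import Level using (Level; suc)
open import Data.Nat.Base as ℕ using (ℕ; _≤_; _<_; _⊔_)
open import Data.Fin.Base using (Fin)
open import Data.Vec.Base using (Vec; []; _∷_; map; reverse; truncate)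
open import Data.Product.Base using (Σ; _×_)
open import Data.Sum.Base using (_⊎_)
open import Data.Unit.Polymorphic.Base using (⊤)
open import Data.Empty.Polymorphic using (⊥)
open import Relation.Nullary.Negation.Core using (¬_)
open import Function.Bundles using (_⇔_)

record Signature : Set where
  field
    size      : ℕ
    arity     : Fin size → ℕ
    arity-pos : ∀ R → 0 < arity R

  Symbol : Set
  Symbol = Fin size

open Signature public using (Symbol; arity)

record Structure (σ : Signature) (ℓ : Level) : Set (suc ℓ) where
  field
    Dom   : Set ℓ
    point : Dom  -- the domain is non-empty
    rel   : (R : Symbol σ) → Vec Dom (arity σ R) → Set ℓ

open Structure public

record Hom {σ : Signature} {ℓ : Level} (𝔄 𝔅 : Structure σ ℓ) : Set ℓ where
  field
    fun      : Dom 𝔄 → Dom 𝔅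
    preserve : ∀ R (as : Vec (Dom 𝔄) (arity σ R)) →
               rel 𝔄 R as → rel 𝔅 R (map fun as)

infixr 7 _∧′_
infixr 6 _∨′_

-- FL σ m is the level FL[m](σ). The arguments of a suffix atom and the
-- variable bound by a quantifier are determined by m, so they are not written.
data FL (σ : Signature) : ℕ → Set where
  ⊤′ ⊥′     : ∀ {m} → FL σ m
  atom      : ∀ {m} (R : Symbol σ) → arity σ R ≤ m → FL σ m
  ¬′_       : ∀ {m} → FL σ m → FL σ m
  _∧′_ _∨′_ : ∀ {m} → FL σ m → FL σ m → FL σ m
  ∃′_ ∀′_   : ∀ {m} → FL σ (ℕ.suc m) → FL σ m

data ExistentialPositive {σ : Signature} : ∀ {m} → FL σ m → Set where
  ⊤′   : ∀ {m} → ExistentialPositive (⊤′ {m = m})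
  ⊥′   : ∀ {m} → ExistentialPositive (⊥′ {m = m})
  atom : ∀ {m} R (r≤m : arity σ R ≤ m) → ExistentialPositive (atom R r≤m)
  _∧′_ : ∀ {m} {φ ψ : FL σ m} →
         ExistentialPositive φ → ExistentialPositive ψ →
         ExistentialPositive (φ ∧′ ψ)
  _∨′_ : ∀ {m} {φ ψ : FL σ m} →
         ExistentialPositive φ → ExistentialPositive ψ →
         ExistentialPositive (φ ∨′ ψ)
  ∃′_  : ∀ {m} {φ : FL σ (ℕ.suc m)} →
         ExistentialPositive φ → ExistentialPositive (∃′ φ)

qr : ∀ {σ m} → FL σ m → ℕ
qr ⊤′         = 0
qr ⊥′         = 0
qr (atom _ _) = 0
qr (¬′ φ)     = qr φ
qr (φ ∧′ ψ)   = qr φ ⊔ qr ψ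
qr (φ ∨′ ψ)   = qr φ ⊔ qr ψ
qr (∃′ φ)     = ℕ.suc (qr φ)
qr (∀′ φ)     = ℕ.suc (qr φ)

-- Assignments list the values of the variables latest first, as
-- x_m ∷ … ∷ x_1 ∷ []. The first r entries, reversed, are therefore the
-- arguments x_{m-r+1}, …, x_m of an r-ary suffix atom.
Sat : ∀ {σ ℓ m} (𝔄 : Structure σ ℓ) → FL σ m → Vec (Dom 𝔄) m → Set ℓ
Sat 𝔄 ⊤′           as = ⊤
Sat 𝔄 ⊥′           as = ⊥
Sat 𝔄 (atom R r≤m) as = rel 𝔄 R (reverse (truncate r≤m as))
Sat 𝔄 (¬′ φ)       as = ¬ Sat 𝔄 φ as
Sat 𝔄 (φ ∧′ ψ)     as = Sat 𝔄 φ as × Sat 𝔄 ψ as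
Sat 𝔄 (φ ∨′ ψ)     as = Sat 𝔄 φ as ⊎ Sat 𝔄 ψ as
Sat 𝔄 (∃′ φ)       as = Σ (Dom 𝔄) λ a → Sat 𝔄 φ (a ∷ as)
Sat 𝔄 (∀′ φ)       as = (a : Dom 𝔄) → Sat 𝔄 φ (a ∷ as)

infix 4 _⊨_

_⊨_ : ∀ {σ ℓ} → Structure σ ℓ → FL σ 0 → Set ℓ
𝔄 ⊨ φ = Sat 𝔄 φ []

PreservedUnderHom : ∀ {σ} (ℓ : Level) → FL σ 0 → Set (suc ℓ)
PreservedUnderHom {σ} ℓ φ =
  (𝔄 𝔅 : Structure σ ℓ) → Hom 𝔄 𝔅 → 𝔄 ⊨ φ → 𝔅 ⊨ φ

Equivalent : ∀ {σ} (ℓ : Level) → FL σ 0 → FL σ 0 → Set (suc ℓ)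
Equivalent {σ} ℓ φ ψ = (𝔄 : Structure σ ℓ) → 𝔄 ⊨ φ ⇔ 𝔄 ⊨ ψ

{-# OPTIONS --safe #-}
-- Let 𝔄 ⊨ φ, let n = qr φ, and let 𝔅 satisfy every existential-positive
-- fluted sentence of rank at most n that holds in 𝔄. Let 𝔇 be two disjoint
-- copies of the forest whose nodes are the non-empty sequences of pairs
-- (a₁ , b₁), …, (a_d , b_d) in which b₁, …, b_d answers a₁, …, a_d in the
-- one-sided n-round game from 𝔄 to 𝔅. In 𝔇 a relation holds of a tuple only
-- if each entry is a child of the preceding one, and is then inherited from 𝔄
-- through the last a's, so that taking the last b's is a homomorphism 𝔇 → 𝔅.
-- The disjoint union 𝔄 ⊎ 𝔇 receives a homomorphism from 𝔄 and agrees with 𝔇 on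
-- fluted sentences of rank n: an element of 𝔄 is answered by a child of the
-- current node, or by a root, and an element of 𝔇 by one of its two copies.
-- Hence a φ preserved under homomorphisms passes along
-- 𝔄 → 𝔄 ⊎ 𝔇 ≡ 𝔇 → 𝔅. Up to equivalence there are only finitely many
-- existential-positive sentences of rank at most n, so ψ can be taken to be
-- the disjunction of those that entail φ. Storing the b's in the nodes avoids
-- any appeal to choice.
module Submission where

open import Defs
open import Level using (Level; suc; Lift; lift; lower)
open import Axiom.ExcludedMiddle using (ExcludedMiddle)
open import Data.Nat.Base using (ℕ; zero; _≤_; _<_; z≤n; s≤s)
open import Data.Nat.Properties
  using (≤-refl; ≤-irrelevant; _≤?_; m≤n⇒m≤1+n; <⇒≱; ⊔-lub; m⊔n≤o⇒m≤o; m⊔n≤o⇒n≤o)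
open import Data.Bool.Base using (Bool; true; false; not; _xor_)
open import Data.Bool.Properties using (not-¬; not-involutive)
open import Data.Product.Base using (Σ; ∃; _×_; _,_; proj₁; proj₂)
open import Data.Product.Function.NonDependent.Propositional using (_×-⇔_)
open import Data.Sum.Base using (_⊎_; inj₁; inj₂; [_,_])
open import Data.Sum.Function.Propositional using (_⊎-⇔_)
open import Data.Unit.Polymorphic.Base using (⊤; tt)
open import Data.Empty using (⊥-elim)
open import Data.Empty.Polymorphic using (⊥)
open import Data.List.Base as List using (List; []; _∷_; _++_; filter)
open import Data.List.Membership.Propositional using (_∈_; find; lose)
open import Data.List.Membership.Propositional.Properties
  using (∈-++⁺ˡ; ∈-++⁺ʳ; ∈-map⁺; ∈-tabulate⁺; ∈-filter⁺; ∈-filter⁻)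
open import Data.List.Relation.Unary.All as All using (All; []; _∷_)
import Data.List.Relation.Unary.All.Properties as All
open import Data.List.Relation.Unary.Any using (Any; here; there)
open import Data.Vec.Base as Vec using (Vec; []; _∷_; reverse; truncate)
open import Data.Vec.Properties
  using (map-∘; map-id; map-reverse; reverse-involutive)
open import Function.Base using (_∘_)
open import Function.Bundles using (_⇔_; mk⇔; Equivalence)
open import Relation.Binary.PropositionalEquality
  using (_≡_; refl; sym; trans; cong; cong₂; subst; module ≡-Reasoning)
open import Relation.Nullary.Decidable.Core using (yes; no; map′)
open import Relation.Nullary.Decidable using (dec-yes-irr)
open import Relation.Nullary.Negation.Core using (¬_)

open Equivalence using (to; from)

private
  variable
    ℓ : Level
    σ : Signature
    m n k : ℕ
    X Y : Set ℓ

-- Homomorphisms and existential-positive formulas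

map-truncate : (f : X → Y) (m≤n : m ≤ n) (xs : Vec X n) →
               Vec.map f (truncate m≤n xs) ≡ truncate m≤n (Vec.map f xs)
map-truncate f z≤n       xs       = refl
map-truncate f (s≤s m≤n) (x ∷ xs) = cong (f x ∷_) (map-truncate f m≤n xs)

map-reverse-truncate : (f : X → Y) (m≤n : m ≤ n) (xs : Vec X n) →
                       Vec.map f (reverse (truncate m≤n xs)) ≡
                       reverse (truncate m≤n (Vec.map f xs))
map-reverse-truncate f m≤n xs =
  trans (map-reverse f (truncate m≤n xs)) (cong reverse (map-truncate f m≤n xs))

Hom-preserves : {𝔄 𝔅 : Structure σ ℓ} (h : Hom 𝔄 𝔅) {φ : FL σ m} →
                ExistentialPositive φ → ∀ as →
                Sat 𝔄 φ as → Sat 𝔅 φ (Vec.map (Hom.fun h) as)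
Hom-preserves h ⊤′           as p        = p
Hom-preserves h ⊥′           as p        = p
Hom-preserves {𝔅 = 𝔅} h (atom R r≤m) as p =
  subst (rel 𝔅 R) (map-reverse-truncate (Hom.fun h) r≤m as) (Hom.preserve h R _ p)
Hom-preserves h (e ∧′ f)     as (p , q)  = Hom-preserves h e as p , Hom-preserves h f as q
Hom-preserves h (e ∨′ f)     as (inj₁ p) = inj₁ (Hom-preserves h e as p)
Hom-preserves h (e ∨′ f)     as (inj₂ q) = inj₂ (Hom-preserves h f as q)
Hom-preserves h (∃′ e)       as (a , p)  = Hom.fun h a , Hom-preserves h e (a ∷ as) p

-- Finite sets of existential-positive formulas

-- One conjunction for each sublist, hence one for the set of listed formulas true at any given
-- tuple.
conjunctions : List (FL σ m) → List (FL σ m)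
conjunctions []       = ⊤′ ∷ []
conjunctions (φ ∷ φs) = conjunctions φs ++ List.map (φ ∧′_) (conjunctions φs)

disjunction : List (FL σ m) → FL σ m
disjunction = List.foldr _∨′_ ⊥′

-- Tabulating over all symbols needs a value at arities above `m`; `⊤′` transfers trivially.
suffixAtom : ∀ σ m → Symbol σ → FL σ m
suffixAtom σ m R with arity σ R ≤? m
... | yes r≤m = atom R r≤m
... | no _    = ⊤′

-- Up to equivalence, the existential-positive formulas of rank at most `k` are the disjunctions of
-- conjunctions of these: `∃` commutes with disjunction, so no disjunction is kept below a
-- quantifier.
basicFormulas : ℕ → ∀ m → List (FL σ m)
basicFormulas {σ} zero      m = List.tabulate (suffixAtom σ m)
basicFormulas {σ} (ℕ.suc k) m =
  List.tabulate (suffixAtom σ m) ++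
  List.map ∃′_ (conjunctions (basicFormulas k (ℕ.suc m)))

suffixAtom-≡ : ∀ σ R (r≤m : arity σ R ≤ m) → suffixAtom σ m R ≡ atom R r≤m
suffixAtom-≡ {m} σ R r≤m
  rewrite dec-yes-irr (arity σ R ≤? m) ≤-irrelevant r≤m = refl

atom∈basicFormulas : ∀ σ k R (r≤m : arity σ R ≤ m) →
                     atom {σ} R r≤m ∈ basicFormulas k m
atom∈basicFormulas σ zero      R r≤m =
  subst (_∈ basicFormulas zero _) (suffixAtom-≡ σ R r≤m)
        (∈-tabulate⁺ {f = suffixAtom σ _} R)
atom∈basicFormulas σ (ℕ.suc k) R r≤m = ∈-++⁺ˡ (atom∈basicFormulas σ zero R r≤m)

EPOfRank≤ : ℕ → FL σ m → Set
EPOfRank≤ k φ = ExistentialPositive φ × qr φ ≤ k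

conjunctions-EP : {φs : List (FL σ m)} →
                  All (EPOfRank≤ k) φs → All (EPOfRank≤ k) (conjunctions φs)
conjunctions-EP []             = (⊤′ , z≤n) ∷ []
conjunctions-EP ((e , q) ∷ es) = All.++⁺ (conjunctions-EP es)
  (All.gmap⁺ (λ (e′ , q′) → e ∧′ e′ , ⊔-lub q q′) (conjunctions-EP es))

disjunction-EP : {φs : List (FL σ m)} →
                 All (EPOfRank≤ k) φs → EPOfRank≤ k (disjunction φs)
disjunction-EP []             = ⊥′ , z≤n
disjunction-EP ((e , q) ∷ es) with disjunction-EP es
... | e′ , q′ = e ∨′ e′ , ⊔-lub q q′

suffixAtom-EP : ∀ σ m (R : Symbol σ) → EPOfRank≤ k (suffixAtom σ m R)
suffixAtom-EP σ m R with arity σ R ≤? m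
... | yes r≤m = atom R r≤m , z≤n
... | no _    = ⊤′ , z≤n

basicFormulas-EP : ∀ k m → All (EPOfRank≤ k) (basicFormulas {σ} k m)
basicFormulas-EP {σ} zero      m = All.tabulate⁺ (suffixAtom-EP σ m)
basicFormulas-EP {σ} (ℕ.suc k) m = All.++⁺ (All.tabulate⁺ (suffixAtom-EP σ m))
  (All.gmap⁺ (λ (e , q) → ∃′ e , s≤s q)
             (conjunctions-EP (basicFormulas-EP k (ℕ.suc m))))

Sat-disjunction : (𝔄 : Structure σ ℓ) (φs : List (FL σ m)) {as : Vec (Dom 𝔄) m} →
                  Sat 𝔄 (disjunction φs) as ⇔ Any (λ φ → Sat 𝔄 φ as) φs
Sat-disjunction 𝔄 []       = mk⇔ (λ ()) (λ ())
Sat-disjunction 𝔄 (φ ∷ φs) = mk⇔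
  (λ { (inj₁ p) → here p ; (inj₂ p) → there (to   (Sat-disjunction 𝔄 φs) p) })
  (λ { (here p) → inj₁ p ; (there p) → inj₂ (from (Sat-disjunction 𝔄 φs) p) })

-- One-sided and two-sided games

Transfers : (𝔄 𝔅 : Structure σ ℓ) →
            Vec (Dom 𝔄) m → Vec (Dom 𝔅) m → FL σ m → Set ℓ
Transfers 𝔄 𝔅 as bs φ = Sat 𝔄 φ as → Sat 𝔅 φ bs

Simulates : (𝔄 𝔅 : Structure σ ℓ) → ℕ → Vec (Dom 𝔄) m → Vec (Dom 𝔅) m → Set ℓ
Simulates {m = m} 𝔄 𝔅 k as bs = All (Transfers 𝔄 𝔅 as bs) (basicFormulas k m)

Simulates-atom : {𝔄 𝔅 : Structure σ ℓ} {as : Vec (Dom 𝔄) m} {bs : Vec (Dom 𝔅) m} →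
                 ∀ k → Simulates 𝔄 𝔅 k as bs → ∀ R (r≤m : arity σ R ≤ m) →
                 Transfers 𝔄 𝔅 as bs (atom R r≤m)
Simulates-atom {σ = σ} k sim R r≤m = All.lookup sim (atom∈basicFormulas σ k R r≤m)

module Classical (em : ExcludedMiddle ℓ) where

  -- `χ` conjoins the listed formulas true at `as`; the false ones transfer vacuously.
  diagram : (𝔄 : Structure σ ℓ) (as : Vec (Dom 𝔄) m) (φs : List (FL σ m)) →
            ∃ λ χ → χ ∈ conjunctions φs × Sat 𝔄 χ as ×
            (∀ 𝔅 bs → Sat 𝔅 χ bs → All (Transfers 𝔄 𝔅 as bs) φs)
  diagram 𝔄 as []       = ⊤′ , here refl , tt , λ _ _ _ → []
  diagram 𝔄 as (φ ∷ φs) with diagram 𝔄 as φs | em {Sat 𝔄 φ as}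
  ... | χ , χ∈ , s , t | yes p =
    φ ∧′ χ , ∈-++⁺ʳ (conjunctions φs) (∈-map⁺ (φ ∧′_) χ∈) , (p , s) ,
    λ { 𝔅 bs (q , u) → (λ _ → q) ∷ t 𝔅 bs u }
  ... | χ , χ∈ , s , t | no ¬p =
    χ , ∈-++⁺ˡ χ∈ , s , λ 𝔅 bs u → (λ p → ⊥-elim (¬p p)) ∷ t 𝔅 bs u

  -- For `χ` the diagram of `a ∷ as`, the formula `∃′ χ` is itself basic at `suc k`, so it
  -- transfers, and its witness in 𝔅 answers `a`.
  Simulates-extend : {𝔄 𝔅 : Structure σ ℓ} {as : Vec (Dom 𝔄) m} {bs : Vec (Dom 𝔅) m} →
                     ∀ k → Simulates 𝔄 𝔅 (ℕ.suc k) as bs →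
                     ∀ a → ∃ λ b → Simulates 𝔄 𝔅 k (a ∷ as) (b ∷ bs)
  Simulates-extend {σ} {m = m} {𝔄} {𝔅} {as} {bs} k sim a
    with diagram 𝔄 (a ∷ as) (basicFormulas k (ℕ.suc m))
  ... | χ , χ∈ , s , t
    with All.lookup sim (∈-++⁺ʳ (List.tabulate (suffixAtom σ m)) (∈-map⁺ ∃′_ χ∈)) (a , s)
  ... | b , u = b , t 𝔅 (b ∷ bs) u

record BackAndForth (𝔄 𝔅 : Structure σ ℓ)
                    (Z : ∀ {m} → ℕ → Vec (Dom 𝔄) m → Vec (Dom 𝔅) m → Set ℓ) : Set ℓ where
  field
    atoms : ∀ {m} {as : Vec (Dom 𝔄) m} {bs} → Z k as bs → ∀ R (r≤m : arity σ R ≤ m) →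
            Sat 𝔄 (atom R r≤m) as ⇔ Sat 𝔅 (atom R r≤m) bs
    forth : ∀ {m} {as : Vec (Dom 𝔄) m} {bs} → Z (ℕ.suc k) as bs →
            ∀ a → ∃ λ b → Z k (a ∷ as) (b ∷ bs)
    back  : ∀ {m} {as : Vec (Dom 𝔄) m} {bs} → Z (ℕ.suc k) as bs →
            ∀ b → ∃ λ a → Z k (a ∷ as) (b ∷ bs)

  Sat-⇔ : ∀ {m} {as : Vec (Dom 𝔄) m} {bs} (φ : FL σ m) → qr φ ≤ k → Z k as bs →
          Sat 𝔄 φ as ⇔ Sat 𝔅 φ bs
  Sat-⇔ ⊤′           q z = mk⇔ (λ _ → tt) (λ _ → tt)
  Sat-⇔ ⊥′           q z = mk⇔ (λ ()) (λ ())
  Sat-⇔ (atom R r≤m) q z = atoms z R r≤m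
  Sat-⇔ (¬′ φ)       q z = mk⇔ (_∘ from (Sat-⇔ φ q z)) (_∘ to (Sat-⇔ φ q z))
  Sat-⇔ (φ ∧′ ψ)     q z =
    Sat-⇔ φ (m⊔n≤o⇒m≤o _ _ q) z ×-⇔ Sat-⇔ ψ (m⊔n≤o⇒n≤o (qr φ) _ q) z
  Sat-⇔ (φ ∨′ ψ)     q z =
    Sat-⇔ φ (m⊔n≤o⇒m≤o _ _ q) z ⊎-⇔ Sat-⇔ ψ (m⊔n≤o⇒n≤o (qr φ) _ q) z
  Sat-⇔ (∃′ φ) (s≤s q) z = mk⇔
    (λ (a , p) → let (b , z′) = forth z a in b , to   (Sat-⇔ φ q z′) p)
    (λ (b , p) → let (a , z′) = back  z b in a , from (Sat-⇔ φ q z′) p)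
  Sat-⇔ (∀′ φ) (s≤s q) z = mk⇔
    (λ p b → let (a , z′) = back  z b in to   (Sat-⇔ φ q z′) (p a))
    (λ p a → let (b , z′) = forth z a in from (Sat-⇔ φ q z′) (p b))

-- Symbols have positive arity, so a sentence of rank 0 contains no atom and is a Boolean
-- combination of `⊤′` and `⊥′`.
rank0-⇔ : (𝔄 𝔅 : Structure σ ℓ) (φ : FL σ 0) → qr φ ≤ 0 → 𝔄 ⊨ φ ⇔ 𝔅 ⊨ φ
rank0-⇔ {σ} {ℓ} 𝔄 𝔅 φ q = BackAndForth.Sat-⇔ game φ q (lift (refl , refl))
  where
  game : BackAndForth 𝔄 𝔅 (λ {m} k _ _ → Lift ℓ (m ≡ 0 × k ≡ 0))
  game = record
    { atoms = λ { (lift (refl , _)) R r≤0 → ⊥-elim (<⇒≱ (Signature.arity-pos σ R) r≤0) }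
    ; forth = λ { (lift (_ , ())) }
    ; back  = λ { (lift (_ , ())) }
    }

-- Structures in which relations hold only along links

-- A common form for `𝔇` and `𝔄⊎𝔇`, so that one lemma compares the atoms of both.
record Linking (A : Set ℓ) : Set (suc ℓ) where
  field
    Carrier : Set ℓ
    base    : Carrier
    link    : Carrier → Carrier → Set ℓ
    val     : Carrier → A

  -- Like assignments, chains are listed latest first.
  Chain : ∀ {m} → Vec Carrier m → Set ℓ
  Chain []           = ⊤
  Chain (_ ∷ [])     = ⊤
  Chain (y ∷ x ∷ xs) = link x y × Chain (x ∷ xs)

open Linking

linked : (𝔄 : Structure σ ℓ) → Linking (Dom 𝔄) → Structure σ ℓ
linked 𝔄 L = record
  { Dom   = Carrier L
  ; point = base L
  ; rel   = λ R xs → Chain L (reverse xs) × rel 𝔄 R (Vec.map (val L) xs)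
  }

module _ {A : Set ℓ} (K L : Linking A) where

  -- All that suffix atoms can detect: values, and links between consecutive entries. A new element
  -- is therefore tested against the latest entry only.
  data Agree : ∀ {m} → Vec (Carrier K) m → Vec (Carrier L) m → Set ℓ where
    empty  : Agree [] []
    single : ∀ {x y} → val K x ≡ val L y → Agree (x ∷ []) (y ∷ [])
    extend : ∀ {m x x′ y y′} {xs : Vec (Carrier K) m} {ys : Vec (Carrier L) m} →
             val K x′ ≡ val L y′ → link K x x′ ⇔ link L y y′ →
             Agree (x ∷ xs) (y ∷ ys) → Agree (x′ ∷ x ∷ xs) (y′ ∷ y ∷ ys)

  Agree-truncate : ∀ {xs : Vec (Carrier K) n} {ys} (m≤n : m ≤ n) →
                   Agree xs ys → Agree (truncate m≤n xs) (truncate m≤n ys)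
  Agree-truncate z≤n             _              = empty
  Agree-truncate (s≤s z≤n)       (single v)     = single v
  Agree-truncate (s≤s z≤n)       (extend v _ _) = single v
  Agree-truncate (s≤s (s≤s m≤n)) (extend v l a) = extend v l (Agree-truncate (s≤s m≤n) a)

  Agree-Chain : ∀ {xs : Vec (Carrier K) m} {ys} → Agree xs ys → Chain K xs ⇔ Chain L ys
  Agree-Chain empty          = mk⇔ (λ _ → tt) (λ _ → tt)
  Agree-Chain (single _)     = mk⇔ (λ _ → tt) (λ _ → tt)
  Agree-Chain (extend _ l a) = l ×-⇔ Agree-Chain a

  Agree-val : ∀ {xs : Vec (Carrier K) m} {ys} → Agree xs ys →
              Vec.map (val K) xs ≡ Vec.map (val L) ys
  Agree-val empty          = refl
  Agree-val (single v)     = cong (_∷ []) v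
  Agree-val (extend v _ a) = cong₂ _∷_ v (Agree-val a)

linked-atom : (𝔄 : Structure σ ℓ) (K L : Linking (Dom 𝔄)) →
              ∀ {xs : Vec (Carrier K) m} {ys} → Agree K L xs ys →
              ∀ R (r≤m : arity σ R ≤ m) →
              Sat (linked 𝔄 K) (atom R r≤m) xs ⇔ Sat (linked 𝔄 L) (atom R r≤m) ys
linked-atom 𝔄 K L {xs} {ys} agree R r≤m
  -- `Sat` reverses the truncated assignment, and `linked` reverses it back to test the chain.
  rewrite reverse-involutive (truncate r≤m xs)
        | reverse-involutive (truncate r≤m ys)
        | map-reverse (val K) (truncate r≤m xs)
        | map-reverse (val L) (truncate r≤m ys)
        | Agree-val K L (Agree-truncate K L r≤m agree)
  = Agree-Chain K L (Agree-truncate K L r≤m agree) ×-⇔ mk⇔ (λ p → p) (λ p → p)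

-- The forest of histories

-- `f xor_` acts on the two copies of the forest as the identity or the swap.
xor-involutive : ∀ f c → f xor (f xor c) ≡ c
xor-involutive false c = refl
xor-involutive true  c = not-involutive c

xor-injective : ∀ f {c d} → f xor c ≡ f xor d → c ≡ d
xor-injective f {c} {d} e =
  trans (sym (xor-involutive f c)) (trans (cong (f xor_) e) (xor-involutive f d))

xor-surjective : ∀ c d → ∃ λ f → f xor c ≡ d
xor-surjective false false = false , refl
xor-surjective false true  = true , refl
xor-surjective true  false = true , refl
xor-surjective true  true  = false , refl

module Forest (em : ExcludedMiddle ℓ) (𝔄 𝔅 : Structure σ ℓ) (n : ℕ)
              (sim₀ : Simulates 𝔄 𝔅 (ℕ.suc n) [] []) where

  open Classical em

  private
    A = Dom 𝔄
    B = Dom 𝔅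

  -- `rank` counts the rounds still to be played.
  record Node : Set ℓ where
    constructor node
    field
      rank    : ℕ
      {depth} : ℕ
      history : Vec (A × B) (ℕ.suc depth)
      sim     : Simulates 𝔄 𝔅 rank (Vec.map proj₁ history) (Vec.map proj₂ history)

  open Node

  last : Node → A × B
  last t = Vec.head (history t)

  data _⋖_ : Node → Node → Set ℓ where
    child : ∀ {k d} {h : Vec (A × B) (ℕ.suc d)} {s p s′} →
            node (ℕ.suc k) h s ⋖ node k (p ∷ h) s′

  root : A → Node
  root a with Simulates-extend n sim₀ a
  -- One of the `suc n` rounds has been spent on `a`.
  ... | b , s = node n ((a , b) ∷ []) s

  last-root : ∀ a → proj₁ (last (root a)) ≡ a
  last-root a with Simulates-extend n sim₀ a
  ... | b , s = refl

  rank-root : ∀ a → rank (root a) ≡ n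
  rank-root a with Simulates-extend n sim₀ a
  ... | b , s = refl

  ¬⋖root : ∀ {t} a → ¬ t ⋖ root a
  ¬⋖root a l with Simulates-extend n sim₀ a
  ¬⋖root a () | b , s

  grow : ∀ t a → k < rank t →
         ∃ λ t′ → t ⋖ t′ × k ≤ rank t′ × proj₁ (last t′) ≡ a
  grow (node (ℕ.suc r) h s) a (s≤s k≤r) with Simulates-extend r s a
  ... | b , s′ = node _ ((a , b) ∷ h) s′ , child , k≤r , refl

  ⋖-rank : ∀ {t t′} → t ⋖ t′ → k < rank t → k ≤ rank t′
  ⋖-rank child (s≤s k≤r) = k≤r

  forest : Linking A
  forest = record
    { Carrier = Bool × Node
    ; base    = false , root (point 𝔄)
    ; link    = λ (c , t) (c′ , t′) → c ≡ c′ × t ⋖ t′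
    ; val     = proj₁ ∘ last ∘ proj₂
    }

  -- With all of 𝔄 linked, the chain condition is vacuous there and 𝔄 keeps its relations; the
  -- missing links across make the union disjoint.
  joinLink : A ⊎ (Bool × Node) → A ⊎ (Bool × Node) → Set ℓ
  joinLink (inj₁ _) (inj₁ _) = ⊤
  joinLink (inj₂ x) (inj₂ y) = link forest x y
  joinLink _        _        = ⊥

  join : Linking A
  join = record
    { Carrier = A ⊎ (Bool × Node)
    ; base    = inj₁ (point 𝔄)
    ; link    = joinLink
    ; val     = [ (λ a → a) , val forest ]
    }

  𝔇 : Structure σ ℓ
  𝔇 = linked 𝔄 forest

  𝔄⊎𝔇 : Structure σ ℓ
  𝔄⊎𝔇 = linked 𝔄 join

  inj₁-Hom : Hom 𝔄 𝔄⊎𝔇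
  inj₁-Hom = record
    { fun      = inj₁
    ; preserve = λ R as p →
        subst (Chain join) (map-reverse inj₁ as) (chain (reverse as)) ,
        subst (rel 𝔄 R) (trans (sym (map-id as)) (map-∘ (val join) inj₁ as)) p
    }
    where
    chain : ∀ {m} (as : Vec A m) → Chain join (Vec.map inj₁ as)
    chain []           = tt
    chain (_ ∷ [])     = tt
    chain (_ ∷ a ∷ as) = tt , chain (a ∷ as)

  -- A child prolongs its parent's history by one pair, so the last pairs along a chain spell out
  -- the history of its latest node.
  Chain-history : ∀ (x : Carrier forest) (xs : Vec (Carrier forest) m) →
                  Chain forest (x ∷ xs) →
                  ∃ λ (m<d : ℕ.suc m ≤ ℕ.suc (depth (proj₂ x))) →
                  Vec.map (last ∘ proj₂) (x ∷ xs) ≡ truncate m<d (history (proj₂ x))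
  Chain-history (_ , node _ (_ ∷ _) _) [] _ = s≤s z≤n , refl
  Chain-history (_ , node _ (_ ∷ _) _) (x ∷ xs) ((_ , child) , l)
    with Chain-history x xs l
  ... | m<d , e = s≤s m<d , cong (_ ∷_) e

  -- A related tuple is a chain, and the simulation stored in its latest node carries the atom from
  -- the a's to the b's.
  last-Hom : Hom 𝔇 𝔅
  last-Hom = record
    { fun      = proj₂ ∘ last ∘ proj₂
    ; preserve = λ R xs (l , p) →
        let (t , r≤d , e) = main R xs (reverse xs) (reverse-involutive xs) l in
        subst (rel 𝔅 R) (sym (e proj₂))
          (Simulates-atom (rank t) (sim t) R r≤d (subst (rel 𝔄 R) (e proj₁) p))
    }
    where
    main : ∀ R (xs ys : Vec (Carrier forest) (arity σ R)) → reverse ys ≡ xs →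
           Chain forest ys →
           ∃ λ t → ∃ λ (r≤d : arity σ R ≤ ℕ.suc (depth t)) →
           ∀ {Z : Set ℓ} (f : A × B → Z) →
           Vec.map (f ∘ last ∘ proj₂) xs ≡ reverse (truncate r≤d (Vec.map f (history t)))
    -- Positive arity provides the chain with a latest node.
    main R with arity σ R | Signature.arity-pos σ R
    ... | ℕ.suc r | _ = λ { _ ys@(x ∷ xs) refl l →
      let (r≤d , e) = Chain-history x xs l in
      proj₂ x , r≤d , λ f → begin
        Vec.map (f ∘ last ∘ proj₂) (reverse ys)
          ≡⟨ map-reverse _ ys ⟩
        reverse (Vec.map (f ∘ last ∘ proj₂) ys)
          ≡⟨ cong reverse (map-∘ f (last ∘ proj₂) ys) ⟩
        reverse (Vec.map f (Vec.map (last ∘ proj₂) ys))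
          ≡⟨ cong (reverse ∘ Vec.map f) e ⟩
        reverse (Vec.map f (truncate r≤d (history (proj₂ x))))
          ≡⟨ cong reverse (map-truncate f r≤d _) ⟩
        reverse (truncate r≤d (Vec.map f (history (proj₂ x)))) ∎ }
      where open ≡-Reasoning

  -- Under `real`, the node must have rank enough to answer `k` further moves by descendants; under
  -- `copy`, moves in the forest are mirrored by the flip `f`.
  data Matched (k : ℕ) : Carrier join → Carrier forest → Set ℓ where
    real : ∀ {a c t} → k ≤ rank t → a ≡ proj₁ (last t) → Matched k (inj₁ a) (c , t)
    copy : ∀ f {c c′ t} → f xor c ≡ c′ → Matched k (inj₂ (c , t)) (c′ , t)

  Matched-val : ∀ {x y} → Matched k x y → val join x ≡ val forest y
  Matched-val (real _ e) = e
  Matched-val (copy _ _) = refl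

  Matched-root : ∀ {c} → k ≤ n → ∀ a → Matched k (inj₁ a) (c , root a)
  Matched-root k≤n a =
    real (subst (_ ≤_) (sym (rank-root a)) k≤n) (sym (last-root a))

  Matched-forth : ∀ {x y} → k ≤ n → Matched (ℕ.suc k) x y → ∀ x′ →
                  ∃ λ y′ → Matched k x′ y′ × (link join x x′ ⇔ link forest y y′)
  Matched-forth k≤n (real {c = c} {t} k<r _) (inj₁ a) with grow t a k<r
  ... | t′ , l , k≤r , e =
    (c , t′) , real k≤r (sym e) , mk⇔ (λ _ → refl , l) (λ _ → tt)
  -- The reply lies in the copy opposite to the current node, which excludes a link even if `t′` is
  -- a child of that node; this is why there are two copies.
  Matched-forth k≤n (real {c = c} _ _) (inj₂ (c′ , t′)) with xor-surjective c′ (not c)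
  ... | f , e = (not c , t′) , copy f e , mk⇔ (λ ()) (λ (e , _) → ⊥-elim (not-¬ refl e))
  -- A root has no parent, so the reply is unlinked, as `a` is in `join`.
  Matched-forth k≤n (copy _ _) (inj₁ a) =
    (false , root a) , Matched-root k≤n a , mk⇔ (λ ()) (λ (_ , l) → ⊥-elim (¬⋖root a l))
  Matched-forth k≤n (copy f refl) (inj₂ (c′ , t′)) =
    (f xor c′ , t′) , copy f refl ,
    mk⇔ (λ (e , l) → cong (f xor_) e , l) (λ (e , l) → xor-injective f e , l)

  Matched-back : ∀ {x y} → Matched (ℕ.suc k) x y → ∀ y′ →
                 ∃ λ x′ → Matched k x′ y′ × (link join x x′ ⇔ link forest y y′)
  -- A child is answered by its last element of 𝔄, any other node by itself.
  Matched-back {y = y} (real k<r _) y′ with em {link forest y y′}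
  ... | yes l = inj₁ _ , real (⋖-rank (proj₂ l) k<r) refl , mk⇔ (λ _ → l) (λ _ → tt)
  ... | no ¬l = inj₂ y′ , copy false refl , mk⇔ (λ ()) (λ l → ⊥-elim (¬l l))
  Matched-back (copy f refl) (c′ , t′) =
    inj₂ (f xor c′ , t′) , copy f (xor-involutive f c′) ,
    mk⇔ (λ (e , l) → trans (cong (f xor_) e) (xor-involutive f c′) , l)
        (λ (e , l) → xor-injective f (trans e (sym (xor-involutive f c′))) , l)

  HeadsMatched : ℕ → Vec (Carrier join) m → Vec (Carrier forest) m → Set ℓ
  HeadsMatched k []      []      = ⊤
  HeadsMatched k (x ∷ _) (y ∷ _) = Matched k x y

  -- The bound leaves `k ≤ n` after a move, so a fresh root, of rank `n`, is always strong enough as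
  -- a reply.
  Position : ℕ → Vec (Carrier join) m → Vec (Carrier forest) m → Set ℓ
  Position k xs ys = k ≤ ℕ.suc n × Agree join forest xs ys × HeadsMatched k xs ys

  game : BackAndForth 𝔄⊎𝔇 𝔇 Position
  game = record
    { atoms = λ (_ , agree , _) → linked-atom 𝔄 join forest agree
    ; forth = forth
    ; back  = back
    }
    where
    forth : ∀ {m} {xs : Vec (Carrier join) m} {ys} → Position (ℕ.suc k) xs ys →
            ∀ x′ → ∃ λ y′ → Position k (x′ ∷ xs) (y′ ∷ ys)
    forth {xs = []} {[]} (s≤s k≤n , _ , _) (inj₁ a) =
      (false , root a) , m≤n⇒m≤1+n k≤n , single (sym (last-root a)) , Matched-root k≤n a
    forth {xs = []} {[]} (s≤s k≤n , _ , _) (inj₂ y) =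
      y , m≤n⇒m≤1+n k≤n , single refl , copy false refl
    forth {xs = _ ∷ _} {_ ∷ _} (s≤s k≤n , agree , M) x′ with Matched-forth k≤n M x′
    ... | y′ , M′ , l = y′ , m≤n⇒m≤1+n k≤n , extend (Matched-val M′) l agree , M′

    back : ∀ {m} {xs : Vec (Carrier join) m} {ys} → Position (ℕ.suc k) xs ys →
           ∀ y′ → ∃ λ x′ → Position k (x′ ∷ xs) (y′ ∷ ys)
    back {xs = []} {[]} (s≤s k≤n , _ , _) y =
      inj₂ y , m≤n⇒m≤1+n k≤n , single refl , copy false refl
    back {xs = _ ∷ _} {_ ∷ _} (s≤s k≤n , agree , M) y′ with Matched-back M y′
    ... | x′ , M′ , l = x′ , m≤n⇒m≤1+n k≤n , extend (Matched-val M′) l agree , M′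

  𝔄⊎𝔇⊨⇔𝔇⊨ : (φ : FL σ 0) → qr φ ≤ ℕ.suc n → 𝔄⊎𝔇 ⊨ φ ⇔ 𝔇 ⊨ φ
  𝔄⊎𝔇⊨⇔𝔇⊨ φ q = BackAndForth.Sat-⇔ game φ q (≤-refl , empty , tt)

-- Preservation and existential-positive definability

module _ (em : ExcludedMiddle (suc ℓ)) where

  em-lower : ExcludedMiddle ℓ
  em-lower = map′ lower lift (em {Lift (suc ℓ) _})

  Preserved⇒transfers : (φ : FL σ 0) → PreservedUnderHom ℓ φ → (𝔄 𝔅 : Structure σ ℓ) →
                        ∀ n → qr φ ≤ n → Simulates 𝔄 𝔅 n [] [] → 𝔄 ⊨ φ → 𝔅 ⊨ φ
  -- Roots cost one round, so the forest is available only from `suc n` on.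
  Preserved⇒transfers φ pres 𝔄 𝔅 zero      q sim p = to (rank0-⇔ 𝔄 𝔅 φ q) p
  Preserved⇒transfers φ pres 𝔄 𝔅 (ℕ.suc n) q sim p =
    pres 𝔇 𝔅 last-Hom (to (𝔄⊎𝔇⊨⇔𝔇⊨ φ q) (pres 𝔄 𝔄⊎𝔇 inj₁-Hom p))
    where open Forest em-lower 𝔄 𝔅 n sim

  Preserved⇒EP : (φ : FL σ 0) → PreservedUnderHom ℓ φ →
                 ∃ λ ψ → ExistentialPositive ψ × qr ψ ≤ qr φ × Equivalent ℓ φ ψ
  Preserved⇒EP {σ} φ pres = disjunction φs , proj₁ φs-EP , proj₂ φs-EP , equivalent
    where
    open Classical em-lower

    Entails-φ : FL σ 0 → Set (suc ℓ)
    Entails-φ χ = (𝔅 : Structure σ ℓ) → 𝔅 ⊨ χ → 𝔅 ⊨ φ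

    χs φs : List (FL σ 0)
    χs = conjunctions (basicFormulas (qr φ) 0)
    -- `Entails-φ` ranges over all structures, so deciding it takes excluded middle at level
    -- `suc ℓ`.
    φs = filter (λ χ → em {Entails-φ χ}) χs

    φs-EP : EPOfRank≤ (qr φ) (disjunction φs)
    φs-EP = disjunction-EP
      (All.filter⁺ (λ χ → em {Entails-φ χ}) (conjunctions-EP (basicFormulas-EP (qr φ) 0)))

    equivalent : Equivalent ℓ φ (disjunction φs)
    equivalent 𝔄 = mk⇔
      -- The diagram of 𝔄 survives the filter: each of its models simulates 𝔄 and hence satisfies
      -- `φ`.
      (λ p → let (χ , χ∈ , s , t) = diagram 𝔄 [] (basicFormulas (qr φ) 0) in
        from (Sat-disjunction 𝔄 φs)
          (lose (∈-filter⁺ (λ χ → em {Entails-φ χ}) χ∈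
                  (λ 𝔅 u → Preserved⇒transfers φ pres 𝔄 𝔅 (qr φ) ≤-refl (t 𝔅 [] u) p))
                s))
      (λ p → let (χ , χ∈ , s) = find (to (Sat-disjunction 𝔄 φs) p) in
        proj₂ (∈-filter⁻ (λ χ → em {Entails-φ χ}) {xs = χs} χ∈) 𝔄 s)

EP⇒Preserved : (φ ψ : FL σ 0) → ExistentialPositive ψ → Equivalent ℓ φ ψ →
               PreservedUnderHom ℓ φ
EP⇒Preserved φ ψ e eq 𝔄 𝔅 h p =
  from (eq 𝔅) (Hom-preserves h e [] (to (eq 𝔄) p))

theorem3p12 : {ℓ : Level} → ExcludedMiddle (suc ℓ) →
    (σ : Signature) (φ : FL σ 0) →
    PreservedUnderHom ℓ φ ⇔
    (Σ (FL σ 0) λ ψ → ExistentialPositive ψ × qr ψ ≤ qr φ × Equivalent ℓ φ ψ)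
theorem3p12 em σ φ = mk⇔ (Preserved⇒EP em φ)
  (λ (ψ , e , _ , eq) → EP⇒Preserved φ ψ e eq)
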